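{- Let $\varphi$ be an unsatisfiable CNF with $n$ variables and let $(T,\{B(t)\}_{t\in V(T)})$ be a one-sided tree decomposition of the incidence graph of $\varphi$ of width $k$, where $T$ is a rooted binary tree. Then there is a regular resolution refutation of $\varphi$ of size $O(4^k n)$.
   Context: A CNF is a set of clauses, each a set of literals. The incidence graph of $\varphi$ is the bipartite graph on variables and clauses of $\varphi$ with $x$ adjacent to $C$ iff $x$ occurs in $C$. A tree decomposition of it with rooted tree $T$ is one-sided if for every clause $C$, the set of nodes whose bags contain $C$ induces a directed path of $T$ (from an ancestor down to a descendant); its width is the maximum bag size minus one. A regular resolution refutation of unsatisfiable $\varphi$ is a DAG with a single source, every non-sink node having exactly two out-neighbours, each non-sink node labelled by a variable so that no variable labels two nodes on one directed path, the two out-edges of a node labelled $x$ labelled $x$ and $\neg x$; each sink $u$ is labelled by a clause $C$ of $\varphi$ such that for every source-to-$u$ path $P$, the set $A(P)$ of edge labels contains $\neg\ell$ for every literal $\ell\in C$. Size is the number of nodes. -}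

module Defs where

open import Data.Nat using (ℕ; _⊔_; _∸_)
open import Data.Fin using (Fin)
import Data.Fin.Properties as FinP
open import Data.Bool using (Bool; true; false; not)
open import Data.List using (List; []; _∷_; length; deduplicate)
open import Data.List.Membership.Propositional using (_∈_)
open import Data.Sum using (_⊎_; inj₁; inj₂)
open import Data.Sum.Properties using (≡-dec)
open import Data.Product using (Σ; _×_; ∃; ∃-syntax; _,_)
open import Relation.Nullary using (¬_)
open import Relation.Binary.PropositionalEquality using (_≡_; _≢_)
open import Relation.Binary.Construct.Closure.ReflexiveTransitive using (Star)
open import Relation.Binary.Construct.Closure.Transitive using (TransClosure)

data Lit (n : ℕ) : Set where
  pos : Fin n → Lit n
  neg : Fin n → Lit n

negLit : ∀ {n} → Lit n → Lit n
negLit (pos x) = neg x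
negLit (neg x) = pos x

-- a clause is a (finite) set of literals, given as a list (membership only matters)
Clause : ℕ → Set
Clause n = List (Lit n)

CNF : ℕ → ℕ → Set
CNF n m = Fin m → Clause n

Assignment : ℕ → Set
Assignment n = Fin n → Bool

evalLit : ∀ {n} → Assignment n → Lit n → Bool
evalLit α (pos x) = α x
evalLit α (neg x) = not (α x)

Satisfies : ∀ {n m} → Assignment n → CNF n m → Set
Satisfies α φ = ∀ j → ∃[ ℓ ] (ℓ ∈ φ j × evalLit α ℓ ≡ true)

Unsatisfiable : ∀ {n m} → CNF n m → Set
Unsatisfiable {n} φ = ¬ (∃[ α ] Satisfies {n} α φ)

Occurs : ∀ {n} → Fin n → Clause n → Set
Occurs x C = pos x ∈ C ⊎ neg x ∈ C

-- Incidence graph: vertices are variables (inj₁) and clauses (inj₂);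
-- x ~ C iff Occurs x (φ C).

Vertex : ℕ → ℕ → Set
Vertex n m = Fin n ⊎ Fin m

data BTree (A : Set) : Set where
  nd0 : A → BTree A
  nd1 : A → BTree A → BTree A
  nd2 : A → BTree A → BTree A → BTree A

data Pos {A : Set} : BTree A → Set where
  here : ∀ {t} → Pos t
  c1   : ∀ {a t} → Pos t → Pos (nd1 a t)
  l2   : ∀ {a t u} → Pos t → Pos (nd2 a t u)
  r2   : ∀ {a t u} → Pos u → Pos (nd2 a t u)

label : ∀ {A} (t : BTree A) → Pos t → A
label (nd0 a)     here   = a
label (nd1 a t)   here   = a
label (nd1 a t)   (c1 p) = label t p
label (nd2 a t u) here   = a
label (nd2 a t u) (l2 p) = label t p
label (nd2 a t u) (r2 p) = label u p

data Child {A : Set} : {t : BTree A} → Pos t → Pos t → Set where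
  ch1  : ∀ {a t} → Child {t = nd1 a t} here (c1 here)
  chl  : ∀ {a t u} → Child {t = nd2 a t u} here (l2 here)
  chr  : ∀ {a t u} → Child {t = nd2 a t u} here (r2 here)
  in1  : ∀ {a t} {p q : Pos t} → Child p q → Child {t = nd1 a t} (c1 p) (c1 q)
  inl2 : ∀ {a t u} {p q : Pos t} → Child p q → Child {t = nd2 a t u} (l2 p) (l2 q)
  inr2 : ∀ {a t u} {p q : Pos u} → Child p q → Child {t = nd2 a t u} (r2 p) (r2 q)

_⊑_ : ∀ {A} {t : BTree A} → Pos t → Pos t → Set
_⊑_ {t = t} = Star (Child {t = t})

Connected : ∀ {A} (t : BTree A) → (Pos t → Set) → Set
Connected t S =
  ∀ p q → S p → S q →
  Star (λ a b → S a × S b × (Child {t = t} a b ⊎ Child {t = t} b a)) p q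

Bag : ℕ → ℕ → Set
Bag n m = List (Vertex n m)

bagSize : ∀ {n m} → Bag n m → ℕ
bagSize b = length (deduplicate (≡-dec FinP._≟_ FinP._≟_) b)

maxBag : ∀ {n m} → BTree (Bag n m) → ℕ
maxBag (nd0 b)     = bagSize b
maxBag (nd1 b t)   = bagSize b ⊔ maxBag t
maxBag (nd2 b t u) = bagSize b ⊔ (maxBag t ⊔ maxBag u)

width : ∀ {n m} → BTree (Bag n m) → ℕ
width T = maxBag T ∸ 1

record TreeDecomposition {n m} (φ : CNF n m) (T : BTree (Bag n m)) : Set where
  field
    covers    : ∀ (v : Vertex n m) → ∃[ p ] (v ∈ label T p)
    edges     : ∀ (x : Fin n) (j : Fin m) → Occurs x (φ j) →
                ∃[ p ] (inj₁ x ∈ label T p × inj₂ j ∈ label T p)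
    connected : ∀ (v : Vertex n m) → Connected T (λ p → v ∈ label T p)

OneSided : ∀ {n m} → BTree (Bag n m) → Set
OneSided {n} {m} T =
  ∀ (j : Fin m) → ∃[ top ] ∃[ bot ] (top ⊑ bot ×
    (∀ p → (inj₂ {A = Fin n} j ∈ label T p → (top ⊑ p × p ⊑ bot))
         × ((top ⊑ p × p ⊑ bot) → inj₂ j ∈ label T p)))

-- Regular resolution refutations (as DAGs / read-once branching programs)
-- with s nodes, the nodes being Fin s.

data NodeLabel (n m s : ℕ) : Set where
  decide : Fin n → (u v : Fin s) → NodeLabel n m s
  sink   : Fin m → NodeLabel n m s

data LEdge {n m s : ℕ} (lab : Fin s → NodeLabel n m s) : Fin s → Lit n → Fin s → Set where
  e-pos : ∀ {w x u v} → lab w ≡ decide x u v → LEdge lab w (pos x) u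
  e-neg : ∀ {w x u v} → lab w ≡ decide x u v → LEdge lab w (neg x) v

Edge : ∀ {n m s} → (Fin s → NodeLabel n m s) → Fin s → Fin s → Set
Edge lab u v = ∃[ ℓ ] LEdge lab u ℓ v

data PathFrom {n m s : ℕ} (lab : Fin s → NodeLabel n m s) (r : Fin s) :
     Fin s → List (Lit n) → Set where
  start : PathFrom lab r r []
  step  : ∀ {u ℓ v A} → PathFrom lab r u A → LEdge lab u ℓ v → PathFrom lab r v (ℓ ∷ A)

record RegularRefutation {n m} (φ : CNF n m) (s : ℕ) : Set where
  field
    lab    : Fin s → NodeLabel n m s
    source : Fin s
    acyclic       : ∀ u → ¬ TransClosure (Edge lab) u u
    source-source : ∀ u → ¬ Edge lab u source
    single-source : ∀ v → (∀ u → ¬ Edge lab u v) → v ≡ source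
    two-out       : ∀ w x u v → lab w ≡ decide x u v → u ≢ v
    regular       : ∀ w w' x x' u v u' v' → TransClosure (Edge lab) w w' →
                    lab w ≡ decide x u v → lab w' ≡ decide x' u' v' → x ≢ x'
    sink-ok       : ∀ w j → lab w ≡ sink j → ∀ A → PathFrom lab source w A →
                    ∀ ℓ → ℓ ∈ φ j → negLit ℓ ∈ A

{-# OPTIONS --safe #-}

-- Dynamic programming over the tree. A state at a node t records the values of
-- the variables in the bag and, for each clause in the bag, whether a variable
-- that no longer occurs below t has satisfied it. Since clauses live on directed
-- paths, an unsatisfied clause is handed to at most one child, so the residual
-- formula splits over the children: either it has a model, or the state is refuted
-- in one child or by a clause whose path ends at t. A variable is queried only
-- at the topmost node whose bag contains it, hence is resolved in at most 2^(k+1)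
-- states; all tree nodes that introduce no variable cost nothing. The resulting
-- derivations are kept as terms; the refutation is the DAG of distinct subterms.
-- A resolution step whose premise lacks the pivot is replaced by that premise,
-- which makes the two out-neighbours of every remaining node distinct.

module Submission where

open import Defs
open import Data.Bool using (Bool; true; false)
import Data.Bool.Properties as Bool
open import Data.Fin using (Fin; zero; suc)
import Data.Fin.Properties as Fin
open import Data.List using (List; []; _∷_; _++_; length; lookup; deduplicate; filter; allFin)
open import Data.List.Properties using (length-++; length-++-sucʳ; length-tabulate)
import Data.List.Membership.DecPropositional as DecMembership
open import Data.List.Membership.Propositional using (_∈_; _∉_; find; lose)
open import Data.List.Membership.Propositional.Properties using (∈-lookup; ∈-∃++; ∈-++⁺ˡ; ∈-++⁺ʳ; ∈-++⁻; ∈-deduplicate⁺; ∈-deduplicate⁻; ∈-filter⁺; ∈-filter⁻; ∈-allFin)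
open import Data.List.Relation.Binary.Subset.Propositional using (_⊆_)
open import Data.List.Relation.Binary.Subset.Propositional.Properties using (++⁺; ⊆-refl)
open import Data.List.Relation.Unary.All as All using (All; []; _∷_)
import Data.List.Relation.Unary.All.Properties as All
open import Data.List.Relation.Unary.AllPairs using ([]; _∷_)
open import Data.List.Relation.Unary.Any using (Any; here; there; index; any?)
open import Data.List.Relation.Unary.Any.Properties using (lookup-index)
import Data.List.Relation.Unary.Unique.DecPropositional.Properties as DecUnique
open import Data.List.Relation.Unary.Unique.Propositional using (Unique)
import Data.List.Relation.Unary.Unique.Propositional.Properties as Unique
open import Data.Nat using (ℕ; suc; _+_; _*_; _^_; _∸_; _≤_; _<_; z≤n; s≤s)
import Data.Nat.Properties as ℕ
open import Data.Nat.Solver using (module +-*-Solver)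
open import Data.Product using (_×_; ∃-syntax; _,_; proj₁; proj₂)
open import Data.Sum using (_⊎_; inj₁; inj₂; [_,_]′)
open import Data.Sum.Properties using (≡-dec)
open import Function using (_∘_)
open import Relation.Binary using (DecidableEquality)
open import Relation.Binary.Construct.Closure.ReflexiveTransitive using (Star; ε; _◅_)
open import Relation.Binary.Construct.Closure.Transitive using (TransClosure; [_]; _∷_)
open import Relation.Binary.PropositionalEquality using (_≡_; _≢_; refl; sym; trans; cong; cong₂; subst)
open import Relation.Nullary using (¬_; Dec; yes; no; does; contradiction)
open import Relation.Nullary.Decidable using (map′; _×-dec_; _⊎-dec_; ¬?; decidable-stable)

-- Injective enumeration and a pigeonhole bound for lists.

lookup-injective : ∀ {A : Set} {xs : List A} → Unique xs → ∀ i j → lookup xs i ≡ lookup xs j → i ≡ j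
lookup-injective (_  ∷ _)  zero    zero    _  = refl
lookup-injective (x∉ ∷ _)  zero    (suc j) eq = contradiction eq (All.lookup x∉ (∈-lookup j))
lookup-injective (x∉ ∷ _)  (suc i) zero    eq = contradiction (sym eq) (All.lookup x∉ (∈-lookup i))
lookup-injective (_  ∷ xs) (suc i) (suc j) eq = cong suc (lookup-injective xs i j eq)

Unique-⊆⇒length≤ : ∀ {A : Set} {xs ys : List A} → Unique xs → xs ⊆ ys → length xs ≤ length ys
Unique-⊆⇒length≤ {xs = []} _ _ = z≤n
Unique-⊆⇒length≤ {xs = x ∷ xs} u@(_ ∷ u′) xs⊆ys with ∈-∃++ (xs⊆ys (here refl))
... | as , bs , refl = ℕ.≤-trans (s≤s (Unique-⊆⇒length≤ u′ xs⊆)) (ℕ.≤-reflexive (sym (length-++-sucʳ as x bs)))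
  where
  xs⊆ : xs ⊆ as ++ bs
  xs⊆ z∈ with ∈-++⁻ as (xs⊆ys (there z∈))
  ... | inj₁ z∈as         = ∈-++⁺ˡ z∈as
  ... | inj₂ (here refl)  = contradiction z∈ (Unique.Unique[x∷xs]⇒x∉xs u)
  ... | inj₂ (there z∈bs) = ∈-++⁺ʳ as z∈bs

var : ∀ {n} → Lit n → Fin n
var (pos x) = x
var (neg x) = x

_≟ˡ_ : ∀ {n} → DecidableEquality (Lit n)
pos x ≟ˡ pos y = map′ (cong pos) (cong var) (x Fin.≟ y)
pos x ≟ˡ neg y = no λ ()
neg x ≟ˡ pos y = no λ ()
neg x ≟ˡ neg y = map′ (cong neg) (cong var) (x Fin.≟ y)

-- Regular derivations and their DAGs

-- Clauses are not stored: the term alone determines the derived clause, so equal subterms can be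
-- merged into one DAG node.
data Derivation (n m : ℕ) : Set where
  axiom   : Fin m → Derivation n m
  resolve : Fin n → (D E : Derivation n m) → Derivation n m

module _ {n m : ℕ} where

  _≟ᵈ_ : DecidableEquality (Derivation n m)
  axiom i ≟ᵈ axiom j = map′ (cong axiom) (λ { refl → refl }) (i Fin.≟ j)
  axiom i ≟ᵈ resolve x D E = no λ ()
  resolve x D E ≟ᵈ axiom i = no λ ()
  resolve x D E ≟ᵈ resolve y F G =
    map′ (λ { (refl , refl , refl) → refl }) (λ { refl → refl , refl , refl })
         (x Fin.≟ y ×-dec (D ≟ᵈ F ×-dec E ≟ᵈ G))

  -- Not the size of the refutation, but a measure that drops strictly along every edge of the DAG.
  size : Derivation n m → ℕ
  size (axiom _)       = 0
  size (resolve _ D E) = suc (size D + size E)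

  data Queries (x : Fin n) : Derivation n m → Set where
    root  : ∀ {D E} → Queries x (resolve x D E)
    left  : ∀ {y D E} → Queries x D → Queries x (resolve y D E)
    right : ∀ {y D E} → Queries x E → Queries x (resolve y D E)

  data Regular : Derivation n m → Set where
    axiom   : ∀ j → Regular (axiom j)
    resolve : ∀ {x D E} → D ≢ E → ¬ Queries x D → ¬ Queries x E →
              Regular D → Regular E → Regular (resolve x D E)

  subs : Derivation n m → List (Derivation n m)
  subs D@(axiom _)       = D ∷ []
  subs D@(resolve _ E F) = D ∷ subs E ++ subs F

  self∈subs : ∀ D → D ∈ subs D
  self∈subs (axiom _)       = here refl
  self∈subs (resolve _ _ _) = here refl

  subs-closed : ∀ R {x D E} → resolve x D E ∈ subs R → D ∈ subs R × E ∈ subs R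
  subs-closed (axiom _) (here ())
  subs-closed (resolve _ F G) (here refl) =
    there (∈-++⁺ˡ (self∈subs F)) , there (∈-++⁺ʳ (subs F) (self∈subs G))
  subs-closed (resolve _ F G) (there p) with ∈-++⁻ (subs F) p
  ... | inj₁ q = let a , b = subs-closed F q in there (∈-++⁺ˡ a) , there (∈-++⁺ˡ b)
  ... | inj₂ q = let a , b = subs-closed G q in there (∈-++⁺ʳ (subs F) a) , there (∈-++⁺ʳ (subs F) b)

  subs-parent : ∀ R {S} → S ∈ subs R → S ≡ R ⊎
    (∃[ x ] ∃[ D ] ∃[ E ] (resolve x D E ∈ subs R × (S ≡ D ⊎ S ≡ E)))
  subs-parent (axiom _)       (here refl) = inj₁ refl
  subs-parent (resolve _ _ _) (here refl) = inj₁ refl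
  subs-parent (resolve x F G) (there p) with ∈-++⁻ (subs F) p
  ... | inj₁ q with subs-parent F q
  ...   | inj₁ refl = inj₂ (x , F , G , here refl , inj₁ refl)
  ...   | inj₂ (y , D , E , r , s) = inj₂ (y , D , E , there (∈-++⁺ˡ r) , s)
  subs-parent (resolve x F G) (there p) | inj₂ q with subs-parent G q
  ...   | inj₁ refl = inj₂ (x , F , G , here refl , inj₂ refl)
  ...   | inj₂ (y , D , E , r , s) = inj₂ (y , D , E , there (∈-++⁺ʳ (subs F) r) , s)

  subs-size : ∀ R {S} → S ∈ subs R → size S ≤ size R
  subs-size (axiom _)       (here refl) = ℕ.≤-refl
  subs-size (resolve _ _ _) (here refl) = ℕ.≤-refl
  subs-size (resolve _ F G) (there p) with ∈-++⁻ (subs F) p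
  ... | inj₁ q = ℕ.m≤n⇒m≤1+n (ℕ.≤-trans (subs-size F q) (ℕ.m≤m+n _ _))
  ... | inj₂ q = ℕ.m≤n⇒m≤1+n (ℕ.≤-trans (subs-size G q) (ℕ.m≤n+m _ _))

  subs-regular : ∀ {R S} → Regular R → S ∈ subs R → Regular S
  subs-regular r@(axiom _)           (here refl) = r
  subs-regular r@(resolve _ _ _ _ _) (here refl) = r
  subs-regular {resolve _ F _} (resolve _ _ _ r s) (there p) with ∈-++⁻ (subs F) p
  ... | inj₁ q = subs-regular r q
  ... | inj₂ q = subs-regular s q

  -- A list satisfying All (Avail L) L contains all subderivations of each of its members.
  Avail : List (Derivation n m) → Derivation n m → Set
  Avail L D = ∀ x E F → D ≡ resolve x E F → E ∈ L × F ∈ L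

  subs⊆ : ∀ {L} → All (Avail L) L → ∀ R → R ∈ L → subs R ⊆ L
  subs⊆ cl (axiom _)       R∈ (here refl) = R∈
  subs⊆ cl (resolve _ _ _) R∈ (here refl) = R∈
  subs⊆ cl (resolve _ F G) R∈ (there p) with ∈-++⁻ (subs F) p | All.lookup cl R∈ _ _ _ refl
  ... | inj₁ q | F∈ , _ = subs⊆ cl F F∈ q
  ... | inj₂ q | _ , G∈ = subs⊆ cl G G∈ q

module _ {n m : ℕ} (φ : CNF n m) where

  -- ℓ ∈ᶜ D: the literal ℓ belongs to the clause derived by D. The premise D of
  -- resolve x D E is reached along the edge x, so it is the one containing ¬x.
  data _∈ᶜ_ (ℓ : Lit n) : Derivation n m → Set where
    axiom : ∀ {j} → ℓ ∈ φ j → ℓ ∈ᶜ axiom j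
    left  : ∀ {x D E} → ℓ ∈ᶜ D → ℓ ≢ neg x → ℓ ∈ᶜ resolve x D E
    right : ∀ {x D E} → ℓ ∈ᶜ E → ℓ ≢ pos x → ℓ ∈ᶜ resolve x D E

  module Dag (R : Derivation n m) (reg : Regular R) (empty : ∀ ℓ → ¬ ℓ ∈ᶜ R) where

    nodes : List (Derivation n m)
    nodes = deduplicate _≟ᵈ_ (subs R)

    Node : Set
    Node = Fin (length nodes)

    at : Node → Derivation n m
    at = lookup nodes

    at-injective : ∀ i j → at i ≡ at j → i ≡ j
    at-injective = lookup-injective (DecUnique.deduplicate-! _≟ᵈ_ (subs R))

    at∈subs : ∀ i → at i ∈ subs R
    at∈subs i = ∈-deduplicate⁻ _≟ᵈ_ (subs R) (∈-lookup i)

    node : ∀ {D} → D ∈ subs R → Node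
    node p = index (∈-deduplicate⁺ _≟ᵈ_ p)

    at-node : ∀ {D} (p : D ∈ subs R) → at (node p) ≡ D
    at-node p = sym (lookup-index (∈-deduplicate⁺ _≟ᵈ_ p))

    -- The term and its membership proof are separate arguments so that the term can be matched on.
    labelOf : ∀ D → D ∈ subs R → NodeLabel n m (length nodes)
    labelOf (axiom j)       _ = sink j
    labelOf (resolve x D E) p =
      decide x (node (proj₁ (subs-closed R p))) (node (proj₂ (subs-closed R p)))

    lab : Node → NodeLabel n m (length nodes)
    lab i = labelOf (at i) (at∈subs i)

    labelOf-decide : ∀ D p {x u v} → labelOf D p ≡ decide x u v → D ≡ resolve x (at u) (at v)
    labelOf-decide (resolve x D E) p refl =
      sym (cong₂ (resolve x) (at-node (proj₁ (subs-closed R p))) (at-node (proj₂ (subs-closed R p))))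

    labelOf-sink : ∀ D p {j} → labelOf D p ≡ sink j → D ≡ axiom j
    labelOf-sink (axiom j) p refl = refl

    -- The successors computed from `p` depend on that proof; they carry the same terms as `u` and
    -- `v`, so injectivity of `at` identifies them.
    labelOf-resolve : ∀ D p {x u v} → D ≡ resolve x (at u) (at v) → labelOf D p ≡ decide x u v
    labelOf-resolve D p refl =
      cong₂ (decide _) (at-injective _ _ (at-node (proj₁ (subs-closed R p))))
                       (at-injective _ _ (at-node (proj₂ (subs-closed R p))))

    decide⇒resolve : ∀ i {x u v} → lab i ≡ decide x u v → at i ≡ resolve x (at u) (at v)
    decide⇒resolve i = labelOf-decide (at i) (at∈subs i)

    edge-size : ∀ {i j} → Edge lab i j → size (at j) < size (at i)
    edge-size {i} (_ , e-pos eq) rewrite decide⇒resolve i eq = s≤s (ℕ.m≤m+n _ _)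
    edge-size {i} (_ , e-neg eq) rewrite decide⇒resolve i eq = s≤s (ℕ.m≤n+m _ _)

    edges-size : ∀ {i j} → TransClosure (Edge lab) i j → size (at j) < size (at i)
    edges-size [ e ]    = edge-size e
    edges-size (e ∷ es) = ℕ.<-trans (edges-size es) (edge-size e)

    edge-queries : ∀ {i j x} → Edge lab i j → Queries x (at j) → Queries x (at i)
    edge-queries {i} (_ , e-pos eq) q rewrite decide⇒resolve i eq = left q
    edge-queries {i} (_ , e-neg eq) q rewrite decide⇒resolve i eq = right q

    edges-queries : ∀ {i j x} → TransClosure (Edge lab) i j → Queries x (at j) → Queries x (at i)
    edges-queries [ e ]    q = edge-queries e q
    edges-queries (e ∷ es) q = edge-queries e (edges-queries es q)

    decide-regular : ∀ i {x u v} → lab i ≡ decide x u v → Regular (resolve x (at u) (at v))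
    decide-regular i eq = subst Regular (decide⇒resolve i eq) (subs-regular reg (at∈subs i))

    decide-queries : ∀ i {x u v} → lab i ≡ decide x u v → Queries x (at i)
    decide-queries i eq rewrite decide⇒resolve i eq = root

    edge-fresh : ∀ {i j x u v} → Edge lab i j → lab i ≡ decide x u v → ¬ Queries x (at j)
    edge-fresh {i} (_ , e-pos eq) eq′ with trans (sym eq) eq′ | decide-regular i eq
    ... | refl | resolve _ x∉ _ _ _ = x∉
    edge-fresh {i} (_ , e-neg eq) eq′ with trans (sym eq) eq′ | decide-regular i eq
    ... | refl | resolve _ _ x∉ _ _ = x∉

    -- The first edge leads to a premise that does not query `x`, and everything reached afterwards
    -- is a subterm of that premise.
    closure-fresh : ∀ {i j x u v} → TransClosure (Edge lab) i j → lab i ≡ decide x u v →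
                    ¬ Queries x (at j)
    closure-fresh [ e ]    eq   = edge-fresh e eq
    closure-fresh (e ∷ es) eq q = edge-fresh e eq (edges-queries es q)

    source : Node
    source = node (self∈subs R)

    at-source : at source ≡ R
    at-source = at-node (self∈subs R)

    no-edge-to-source : ∀ i → ¬ Edge lab i source
    no-edge-to-source i e =
      ℕ.<⇒≱ (edge-size e) (subst (λ D → size (at i) ≤ size D) (sym at-source) (subs-size R (at∈subs i)))

    parent-edges : ∀ {x D E} (p : resolve x D E ∈ subs R) i → at i ≡ D ⊎ at i ≡ E →
                   Edge lab (node p) i
    parent-edges p i c with subs-closed R p
    ... | D∈ , E∈ = edge c
      where
      eq : lab (node p) ≡ decide _ (node D∈) (node E∈)
      eq = labelOf-resolve (at (node p)) _
             (trans (at-node p) (sym (cong₂ (resolve _) (at-node D∈) (at-node E∈))))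
      edge : at i ≡ _ ⊎ at i ≡ _ → Edge lab (node p) i
      edge (inj₁ c) rewrite at-injective i (node D∈) (trans c (sym (at-node D∈))) = _ , e-pos eq
      edge (inj₂ c) rewrite at-injective i (node E∈) (trans c (sym (at-node E∈))) = _ , e-neg eq

    no-parent⇒source : ∀ i → (∀ u → ¬ Edge lab u i) → i ≡ source
    no-parent⇒source i orphan with subs-parent R (at∈subs i)
    ... | inj₁ eq                  = at-injective i source (trans eq (sym at-source))
    ... | inj₂ (_ , _ , _ , p , c) = contradiction (parent-edges p i c) (orphan (node p))

    -- Induction along the path: the clause at the source is empty, and the only literal of a
    -- premise that the resolvent may lack is the one negated by the edge label.
    path-falsifies : ∀ {i A} → PathFrom lab source i A → ∀ ℓ → ℓ ∈ᶜ at i → negLit ℓ ∈ A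
    path-falsifies start ℓ ℓ∈ = contradiction (subst (ℓ ∈ᶜ_) at-source ℓ∈) (empty ℓ)
    path-falsifies (step {u = u} P (e-pos {x = x} eq)) ℓ ℓ∈ with ℓ ≟ˡ neg x
    ... | yes refl = here refl
    ... | no ℓ≢    = there (path-falsifies P ℓ (subst (ℓ ∈ᶜ_) (sym (decide⇒resolve u eq)) (left ℓ∈ ℓ≢)))
    path-falsifies (step {u = u} P (e-neg {x = x} eq)) ℓ ℓ∈ with ℓ ≟ˡ pos x
    ... | yes refl = here refl
    ... | no ℓ≢    = there (path-falsifies P ℓ (subst (ℓ ∈ᶜ_) (sym (decide⇒resolve u eq)) (right ℓ∈ ℓ≢)))

    refutation : RegularRefutation φ (length nodes)
    refutation = record
      { lab           = lab
      ; source        = source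
      ; acyclic       = λ _ c → ℕ.<-irrefl refl (edges-size c)
      ; source-source = no-edge-to-source
      ; single-source = no-parent⇒source
      ; two-out       = λ { w _ u _ eq refl → distinct (decide-regular w eq) refl }
      ; regular       = λ { _ w′ _ _ _ _ _ _ c eq eq′ refl → closure-fresh c eq (decide-queries w′ eq′) }
      ; sink-ok       = λ w j eq A P ℓ ℓ∈ →
          path-falsifies P ℓ (subst (ℓ ∈ᶜ_) (sym (labelOf-sink (at w) (at∈subs w) eq)) (axiom ℓ∈))
      }
      where
      distinct : ∀ {x D E} → Regular (resolve x D E) → D ≢ E
      distinct (resolve D≢E _ _ _ _) = D≢E

    -- Reduces the size bound to counting the derivations ever recorded: `nodes` has no repetitions,
    -- and a list closed under premises contains every subterm of its members.
    length-nodes≤ : ∀ {L} → All (Avail L) L → R ∈ L → length nodes ≤ length L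
    length-nodes≤ cl R∈ =
      Unique-⊆⇒length≤ (DecUnique.deduplicate-! _≟ᵈ_ (subs R))
                       (subs⊆ cl R R∈ ∘ ∈-deduplicate⁻ _≟ᵈ_ (subs R))

-- Reflected decisions and tables of Boolean functions.

does-true : ∀ {P : Set} (d : Dec P) → does d ≡ true → P
does-true (yes p) refl = p

does-false : ∀ {P : Set} (d : Dec P) → does d ≡ false → ¬ P
does-false (no ¬p) refl = ¬p

module _ {V : Set} (_≟_ : DecidableEquality V) where

  update : (V → Bool) → V → Bool → V → Bool
  update f v b w with v ≟ w
  ... | yes _ = b
  ... | no  _ = f w

  update-≡ : ∀ f v b → update f v b v ≡ b
  update-≡ f v b with v ≟ v
  ... | yes _  = refl
  ... | no v≢v = contradiction refl v≢v

  update-≢ : ∀ f v b {w} → v ≢ w → update f v b w ≡ f w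
  update-≢ f v b {w} v≢w with v ≟ w
  ... | yes v≡w = contradiction v≡w v≢w
  ... | no  _   = refl

  update-self : ∀ f v w → update f v (f v) w ≡ f w
  update-self f v w with v ≟ w
  ... | yes refl = refl
  ... | no  _    = refl

  update-cong : ∀ {f g vs} v b → (∀ w → w ∈ vs → f w ≡ g w) →
                ∀ w → w ∈ v ∷ vs → update f v b w ≡ update g v b w
  update-cong v b f≗g w w∈ with v ≟ w
  update-cong v b f≗g w w∈          | yes _  = refl
  update-cong v b f≗g w (here refl) | no v≢v = contradiction refl v≢v
  update-cong v b f≗g w (there w∈)  | no _   = f≗g w w∈

  -- Only the values on vs matter, so 2 ^ length vs representatives serve all f.
  tabulateAll : ∀ {A : Set} (R : A → Set) c (vs : List V) (P : List A → (V → Bool) → Set) →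
    (∀ {M M′ f} → M ⊆ M′ → P M f → P M′ f) →
    (∀ {M f g} → (∀ v → v ∈ vs → f v ≡ g v) → P M f → P M g) →
    (∀ f → ∃[ M ] (length M ≤ c × All R M × P M f)) →
    ∃[ M ] (length M ≤ 2 ^ length vs * c × All R M × (∀ f → P M f))
  tabulateAll R c [] P mono resp one with one (λ _ → false)
  ... | M , len , all , p = M , ℕ.≤-trans len (ℕ.≤-reflexive (sym (ℕ.+-identityʳ c))) , all ,
                            λ f → resp (λ _ ()) p
  tabulateAll R c (v ∷ vs) P mono resp one
    with half true | half false
    where
    half : ∀ b → ∃[ M ] (length M ≤ 2 ^ length vs * c × All R M × (∀ f → P M (update f v b)))
    half b = tabulateAll R c vs (λ M f → P M (update f v b)) mono
                         (λ f≗g → resp (update-cong v b f≗g)) (λ f → one (update f v b))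
  ... | M₁ , len₁ , all₁ , p₁ | M₀ , len₀ , all₀ , p₀ =
    -- Updating `f` at `v` by its own value changes nothing, so `f` is served by the half that fixes
    -- `f v`.
    M₁ ++ M₀ , len , All.++⁺ all₁ all₀ , λ f → resp (λ w _ → update-self f v w) (combine f (f v))
    where
    len : length (M₁ ++ M₀) ≤ 2 ^ suc (length vs) * c
    len = begin
      length (M₁ ++ M₀)                        ≡⟨ length-++ M₁ ⟩
      length M₁ + length M₀                    ≤⟨ ℕ.+-mono-≤ len₁ len₀ ⟩
      2 ^ length vs * c + 2 ^ length vs * c    ≡⟨ ℕ.*-distribʳ-+ c (2 ^ length vs) _ ⟨
      (2 ^ length vs + 2 ^ length vs) * c      ≡⟨ cong (λ k → (2 ^ length vs + k) * c) (ℕ.+-identityʳ _) ⟨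
      2 ^ suc (length vs) * c                  ∎
      where open ℕ.≤-Reasoning
    combine : ∀ f b → P (M₁ ++ M₀) (update f v b)
    combine f true  = mono ∈-++⁺ˡ (p₁ f)
    combine f false = mono (∈-++⁺ʳ M₁) (p₀ f)

evalLit-cong : ∀ {n} {α β : Assignment n} ℓ → α (var ℓ) ≡ β (var ℓ) → evalLit α ℓ ≡ evalLit β ℓ
evalLit-cong (pos x) eq = eq
evalLit-cong (neg x) eq rewrite eq = refl

occurs : ∀ {n} {C : Clause n} {ℓ} → ℓ ∈ C → Occurs (var ℓ) C
occurs {ℓ = pos x} = inj₁
occurs {ℓ = neg x} = inj₂

State : ℕ → ℕ → Set
State n m = Vertex n m → Bool

-- Trees of bags, with conditions relating each bag to its children only

-- `nil` pads every node to two children, so leaves, unary and binary nodes share one case.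
data Tree (n m : ℕ) : Set where
  nil  : Tree n m
  node : (B : Bag n m) (l r : Tree n m) → Tree n m

module _ {n m : ℕ} where

  _≟ᵛ_ : DecidableEquality (Vertex n m)
  _≟ᵛ_ = ≡-dec Fin._≟_ Fin._≟_

  open DecMembership _≟ᵛ_ using (_∈?_)

  data Somewhere (Q : Bag n m → Set) : Tree n m → Set where
    top   : ∀ {B l r} → Q B → Somewhere Q (node B l r)
    left  : ∀ {B l r} → Somewhere Q l → Somewhere Q (node B l r)
    right : ∀ {B l r} → Somewhere Q r → Somewhere Q (node B l r)

  mapSomewhere : ∀ {P Q : Bag n m → Set} → (∀ {B} → P B → Q B) → ∀ {t} → Somewhere P t → Somewhere Q t
  mapSomewhere f (top p)   = top (f p)
  mapSomewhere f (left s)  = left (mapSomewhere f s)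
  mapSomewhere f (right s) = right (mapSomewhere f s)

  _∈ᵗ_ : Vertex n m → Tree n m → Set
  v ∈ᵗ t = Somewhere (v ∈_) t

  _∈ᵗ?_ : ∀ v t → Dec (v ∈ᵗ t)
  v ∈ᵗ? nil = no λ ()
  v ∈ᵗ? node B l r =
    map′ [ top , [ left , right ]′ ]′
         (λ { (top p) → inj₁ p ; (left p) → inj₂ (inj₁ p) ; (right p) → inj₂ (inj₂ p) })
         (v ∈? B ⊎-dec (v ∈ᵗ? l ⊎-dec v ∈ᵗ? r))

  rootBag : Tree n m → Bag n m
  rootBag nil          = []
  rootBag (node B _ _) = B

  root∈ : ∀ {v} t → v ∈ rootBag t → v ∈ᵗ t
  root∈ (node _ _ _) v∈ = top v∈

  Connects : Bag n m → Tree n m → Set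
  Connects B t = ∀ {v} → v ∈ B → v ∈ᵗ t → v ∈ rootBag t

  -- Besides connectedness across each tree edge, this asks that a bag separate its two subtrees and
  -- that no clause path fork: the local residue of one-sidedness.
  data Sound (K : ℕ) : Tree n m → Set where
    nil  : Sound K nil
    node : ∀ {B l r} → bagSize B ≤ K → Connects B l → Connects B r →
           (∀ {v} → v ∈ᵗ l → v ∈ᵗ r → v ∈ B) →
           (∀ {j} → inj₂ j ∈ rootBag l → inj₂ j ∉ rootBag r) →
           Sound K l → Sound K r → Sound K (node B l r)

  rootSize : ∀ {K t} → Sound K t → bagSize (rootBag t) ≤ K
  rootSize nil                    = z≤n
  rootSize (node len _ _ _ _ _ _) = len

  -- c is either child of the node t with bag B, and c′ is its sibling.
  record Side (B : Bag n m) (t c c′ : Tree n m) : Set₁ where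
    field
      up       : ∀ {Q} → Somewhere Q c → Somewhere Q t
      split    : ∀ {Q} → Somewhere Q t → Q B ⊎ (Somewhere Q c ⊎ Somewhere Q c′)
      connects : Connects B c
      connects′ : Connects B c′
      separates : ∀ {v} → v ∈ᵗ c → v ∈ᵗ c′ → v ∈ B
      one-sided : ∀ {j} → inj₂ j ∈ rootBag c → inj₂ j ∉ rootBag c′

  leftSide : ∀ {K B l r} → Sound K (node B l r) → Side B (node B l r) l r
  leftSide (node _ cl cr sep os _ _) = record
    { up = left
    ; split = λ { (top q) → inj₁ q ; (left s) → inj₂ (inj₁ s) ; (right s) → inj₂ (inj₂ s) }
    ; connects = cl ; connects′ = cr ; separates = sep ; one-sided = os }

  rightSide : ∀ {K B l r} → Sound K (node B l r) → Side B (node B l r) r l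
  rightSide (node _ cl cr sep os _ _) = record
    { up = right
    ; split = λ { (top q) → inj₁ q ; (left s) → inj₂ (inj₂ s) ; (right s) → inj₂ (inj₁ s) }
    ; connects = cr ; connects′ = cl ; separates = λ p q → sep q p ; one-sided = λ p q → os q p }

  -- With `B` the bag of the parent, connectedness makes the root of `t` the topmost node for these
  -- variables; they are eliminated there.
  new : Bag n m → Tree n m → List (Fin n)
  new B t = filter (λ x → inj₁ x ∈? rootBag t ×-dec ¬? (inj₁ x ∈? B)) (allFin n)

  ∈new⁻ : ∀ {B t x} → x ∈ new B t → inj₁ x ∈ rootBag t × inj₁ x ∉ B
  ∈new⁻ {B} {t} x∈ = proj₂ (∈-filter⁻ (λ x → inj₁ x ∈? rootBag t ×-dec ¬? (inj₁ x ∈? B)) {xs = allFin n} x∈)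

  ∈new⁺ : ∀ {B t x} → inj₁ x ∈ rootBag t → inj₁ x ∉ B → x ∈ new B t
  ∈new⁺ {B} {t} x∈ x∉ = ∈-filter⁺ (λ x → inj₁ x ∈? rootBag t ×-dec ¬? (inj₁ x ∈? B)) (∈-allFin _) (x∈ , x∉)

  -- The root bag contributes nothing: whether its variables are new depends on a parent bag, known
  -- only one level up.
  introduced : Tree n m → List (Fin n)
  introduced nil          = []
  introduced (node B l r) = (new B l ++ introduced l) ++ (new B r ++ introduced r)

  introduced⁻ : ∀ {K t x} → Sound K t → x ∈ introduced t → inj₁ x ∈ᵗ t × inj₁ x ∉ rootBag t
  new-introduced⁻ : ∀ {K B t x} → Sound K t → Connects B t → x ∈ new B t ++ introduced t →
                    inj₁ x ∈ᵗ t × inj₁ x ∉ B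

  introduced⁻ {t = node B l r} (node _ cl cr _ _ sl sr) x∈ with ∈-++⁻ (new B l ++ introduced l) x∈
  ... | inj₁ p = let q , x∉ = new-introduced⁻ sl cl p in left q , x∉
  ... | inj₂ p = let q , x∉ = new-introduced⁻ sr cr p in right q , x∉

  new-introduced⁻ {B = B} {t} s c x∈ with ∈-++⁻ (new B t) x∈
  ... | inj₁ p = let x∈t , x∉ = ∈new⁻ {B} {t} p in root∈ t x∈t , x∉
  ... | inj₂ p = let x∈t , x∉ = introduced⁻ s p in x∈t , λ x∈B → x∉ (c x∈B x∈t)

  -- A variable met in both subtrees lies in `B` and is introduced in neither; within one subtree,
  -- new variables lie in its root bag and those introduced deeper do not. Hence at most `n`
  -- variables are ever charged.
  introduced-unique : ∀ {K t} → Sound K t → Unique (introduced t)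
  introduced-unique nil = []
  introduced-unique {t = node B l r} (node _ cl cr sep _ sl sr) =
    Unique.++⁺ (part sl) (part sr)
      λ (p , q) → let x∈l , x∉B = new-introduced⁻ sl cl p in
                  x∉B (sep x∈l (proj₁ (new-introduced⁻ sr cr q)))
    where
    part : ∀ {t} → Sound _ t → Unique (new B t ++ introduced t)
    part {t} s = Unique.++⁺ (Unique.filter⁺ _ (Unique.allFin⁺ n)) (introduced-unique s)
      λ (p , q) → proj₂ (introduced⁻ s q) (proj₁ (∈new⁻ {B} {t} p))

  length-introduced : ∀ {K t} → Sound K t → length (introduced t) ≤ n
  length-introduced s =
    ℕ.≤-trans (Unique-⊆⇒length≤ (introduced-unique s) (λ _ → ∈-allFin _))
              (ℕ.≤-reflexive (length-tabulate {n = n} _))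

  Avail-mono : ∀ {L L′ : List (Derivation n m)} {D} → L ⊆ L′ → Avail L D → Avail L′ D
  Avail-mono L⊆ av x E F eq = let p , q = av x E F eq in L⊆ p , L⊆ q

  Closed : List (Derivation n m) → Set
  Closed L = All (Avail L) L

  Closed-++ : ∀ {L L′} → Closed L → Closed L′ → Closed (L ++ L′)
  Closed-++ {L} {L′} c c′ = All.++⁺ (All.map (λ {D} → Avail-mono {D = D} ∈-++⁺ˡ) c)
                                    (All.map (λ {D} → Avail-mono {D = D} (∈-++⁺ʳ L)) c′)

  Closed-extend : ∀ {L M} → All (Avail L) M → Closed L → Closed (M ++ L)
  Closed-extend {L} {M} a c = All.map (λ {D} → Avail-mono {D = D} (∈-++⁺ʳ M)) (All.++⁺ a c)

  _[_≔_] : State n m → Fin n → Bool → State n m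
  f [ x ≔ b ] = update _≟ᵛ_ f (inj₁ x) b

  value : State n m → Lit n → Bool
  value f ℓ = evalLit (f ∘ inj₁) ℓ

-- The dynamic program

module DP {n m : ℕ} (φ : CNF n m) where

  open DecMembership (_≟ᵛ_ {n} {m}) using (_∈?_)
  open DecMembership (_≟ˡ_ {n}) using () renaming (_∈?_ to _∈ˡ?_)

  derives? : ∀ ℓ D → Dec (_∈ᶜ_ φ ℓ D)
  derives? ℓ (axiom j) = map′ axiom (λ { (axiom p) → p }) (ℓ ∈ˡ? φ j)
  derives? ℓ (resolve x D E) =
    map′ [ (λ (p , q) → left p q) , (λ (p , q) → right p q) ]′
         (λ { (left p q) → inj₁ (p , q) ; (right p q) → inj₂ (p , q) })
         ((derives? ℓ D ×-dec ¬? (ℓ ≟ˡ neg x)) ⊎-dec (derives? ℓ E ×-dec ¬? (ℓ ≟ˡ pos x)))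

  Shared : Fin n → Fin m → Bag n m → Set
  Shared x j B = inj₁ x ∈ B × inj₂ j ∈ B

  -- B is the bag of the parent of t; the second alternative is for edges realised only outside t.
  Edges : Bag n m → Tree n m → Set
  Edges B t = ∀ {x j} → Occurs x (φ j) → inj₂ j ∈ᵗ t →
    Somewhere (Shared x j) t ⊎ (inj₂ j ∈ B × (inj₁ x ∈ᵗ t → inj₁ x ∈ rootBag t))

  -- For an edge not realised in `c`, the clause is in `B` by connectedness or separation, and the
  -- variable, if it occurs in `c` at all, is in `B` too and hence in the root bag of `c`.
  childEdges : ∀ {B₀ B l r c c′} → Connects B₀ (node B l r) → Side B (node B l r) c c′ →
               Edges B₀ (node B l r) → Edges B c
  childEdges conn side edges occ j∈c with edges occ (Side.up side j∈c)
  ... | inj₂ (j∈B₀ , x↑) =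
        inj₂ (conn j∈B₀ (up j∈c) , λ x∈c → connects (x↑ (up x∈c)) x∈c)
    where open Side side
  ... | inj₁ s with Side.split side s
  ...   | inj₁ (x∈B , j∈B) = inj₂ (j∈B , Side.connects side x∈B)
  ...   | inj₂ (inj₁ s′)   = inj₁ s′
  ...   | inj₂ (inj₂ s′)   =
          inj₂ (separates j∈c (mapSomewhere proj₂ s′) ,
                λ x∈c → connects (separates x∈c (mapSomewhere proj₁ s′)) x∈c)
    where open Side side

  -- In a state f at t, f (inj₁ x) is the value of a variable x of the root bag
  -- (meaningless for x ∈ ys), and f (inj₂ j) tells whether clause j of the root
  -- bag is satisfied by a variable that does not occur in t.

  SatisfiedIn : Assignment n → Tree n m → Fin m → Set
  SatisfiedIn α t j = ∃[ ℓ ] (ℓ ∈ φ j × inj₁ (var ℓ) ∈ᵗ t × evalLit α ℓ ≡ true)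

  record Model (t : Tree n m) (ys : List (Fin n)) (f : State n m) : Set where
    constructor model
    field
      α      : Assignment n
      agrees : ∀ x → inj₁ x ∈ rootBag t → x ∉ ys → α x ≡ f (inj₁ x)
      sat    : ∀ j → inj₂ j ∈ᵗ t → (inj₂ j ∈ rootBag t × f (inj₂ j) ≡ true) ⊎ SatisfiedIn α t j

  -- The literals allowed in a clause that refutes the state. A flag `false` asserts that nothing
  -- outside `t` satisfies clause `j`, so its literals on outside variables count as false.
  Falsified : Tree n m → List (Fin n) → State n m → Lit n → Set
  Falsified t ys f ℓ =
    (inj₁ (var ℓ) ∈ rootBag t × var ℓ ∉ ys × value f ℓ ≡ false) ⊎
    (¬ inj₁ (var ℓ) ∈ᵗ t × ∃[ j ] (inj₂ j ∈ rootBag t × f (inj₂ j) ≡ false × ℓ ∈ φ j))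

  -- Only the premises of `D` must be in `L`, so handing `D` on to the parent adds nothing to the
  -- list. `queries` keeps variables of the root bag fresh until they are eliminated.
  record Refuted (L : List (Derivation n m)) (t : Tree n m) (ys : List (Fin n)) (f : State n m) : Set where
    constructor refuted
    field
      D         : Derivation n m
      regular   : Regular D
      avail     : Avail L D
      falsified : ∀ ℓ → _∈ᶜ_ φ ℓ D → Falsified t ys f ℓ
      queries   : ∀ x → Queries x D → inj₁ x ∈ᵗ t × (inj₁ x ∉ rootBag t ⊎ x ∈ ys)

  Result : List (Derivation n m) → Tree n m → List (Fin n) → State n m → Set
  Result L t ys f = Model t ys f ⊎ Refuted L t ys f

  Result-mono : ∀ {L L′ t ys f} → L ⊆ L′ → Result L t ys f → Result L′ t ys f
  Result-mono L⊆ (inj₁ M)                       = inj₁ M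
  Result-mono L⊆ (inj₂ (refuted D reg av fa q)) = inj₂ (refuted D reg (Avail-mono {D = D} L⊆ av) fa q)

  Falsified-cong : ∀ {t ys f g} → (∀ v → v ∈ rootBag t → f v ≡ g v) →
                   ∀ ℓ → Falsified t ys f ℓ → Falsified t ys g ℓ
  Falsified-cong f≗g ℓ (inj₁ (x∈ , x∉ , eq)) =
    inj₁ (x∈ , x∉ , trans (sym (evalLit-cong ℓ (f≗g _ x∈))) eq)
  Falsified-cong f≗g ℓ (inj₂ (x∉ , j , j∈ , eq , ℓ∈)) =
    inj₂ (x∉ , j , j∈ , trans (sym (f≗g _ j∈)) eq , ℓ∈)

  Result-cong : ∀ {L t ys f g} → (∀ v → v ∈ rootBag t → f v ≡ g v) → Result L t ys f → Result L t ys g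
  Result-cong f≗g (inj₁ (model α ag sat)) = inj₁ (model α
    (λ x x∈ x∉ → trans (ag x x∈ x∉) (f≗g _ x∈))
    (λ j j∈ → [ (λ (p , eq) → inj₁ (p , trans (sym (f≗g _ p)) eq)) , inj₂ ]′ (sat j j∈)))
  Result-cong f≗g (inj₂ (refuted D reg av fa q)) =
    inj₂ (refuted D reg av (λ ℓ ℓ∈ → Falsified-cong f≗g ℓ (fa ℓ ℓ∈)) q)

  -- Eliminating a variable of the root bag by resolution.

  module Query (t : Tree n m) (y : Fin n) (ys : List (Fin n))
               (y∈ : inj₁ y ∈ rootBag t) (y∉ : y ∉ ys) where

    forget-≡ : ∀ (f : State n m) b {x} → x ∉ y ∷ ys → (f [ y ≔ b ]) (inj₁ x) ≡ f (inj₁ x)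
    forget-≡ f b x∉ = update-≢ _≟ᵛ_ f (inj₁ y) b λ { refl → x∉ (here refl) }

    Model-forget : ∀ {f} b → Model t ys (f [ y ≔ b ]) → Model t (y ∷ ys) f
    Model-forget {f} b (model α ag sat) =
      model α (λ x x∈ x∉ → trans (ag x x∈ (x∉ ∘ there)) (forget-≡ f b x∉)) sat

    falsified-y : ∀ {f ℓ} → var ℓ ≡ y → Falsified t ys f ℓ → value f ℓ ≡ false
    falsified-y refl (inj₁ (_ , _ , eq)) = eq
    falsified-y refl (inj₂ (y∉t , _))    = contradiction (root∈ t y∈) y∉t

    pos-true : ∀ (f : State n m) → value (f [ y ≔ true ]) (pos y) ≢ false
    pos-true f eq with () ← trans (sym (update-≡ _≟ᵛ_ f (inj₁ y) true)) eq

    neg-true : ∀ (f : State n m) → value (f [ y ≔ false ]) (neg y) ≢ false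
    neg-true f eq rewrite update-≡ _≟ᵛ_ f (inj₁ y) false with () ← eq

    Falsified-forget : ∀ {f b ℓ} → ¬ (var ℓ ≡ y × value (f [ y ≔ b ]) ℓ ≡ false) →
                       Falsified t ys (f [ y ≔ b ]) ℓ → Falsified t (y ∷ ys) f ℓ
    Falsified-forget ≢ (inj₂ p) = inj₂ p
    Falsified-forget {f} {b} {ℓ} ≢ (inj₁ (x∈ , x∉ , eq)) with var ℓ Fin.≟ y
    ... | yes refl = contradiction (refl , eq) ≢
    ... | no x≢y   = inj₁ (x∈ , x∉′ , trans (sym (evalLit-cong ℓ (forget-≡ f b x∉′))) eq)
      where
      x∉′ : var ℓ ∉ y ∷ ys
      x∉′ (here x≡y)  = x≢y x≡y
      x∉′ (there x∈′) = x∉ x∈′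

    -- Under `y ≔ true` the literal `pos y` cannot be falsified, so `neg y` is the only literal on
    -- `y` that could obstruct forgetting it, and resolution removes exactly that one.
    Falsified-forget⁺ : ∀ {f ℓ} → ℓ ≢ neg y → Falsified t ys (f [ y ≔ true ]) ℓ → Falsified t (y ∷ ys) f ℓ
    Falsified-forget⁺ {f} {pos _} _  = Falsified-forget λ { (refl , eq) → pos-true f eq }
    Falsified-forget⁺ {f} {neg _} ℓ≢ = Falsified-forget λ { (refl , _) → ℓ≢ refl }

    Falsified-forget⁻ : ∀ {f ℓ} → ℓ ≢ pos y → Falsified t ys (f [ y ≔ false ]) ℓ → Falsified t (y ∷ ys) f ℓ
    Falsified-forget⁻ {f} {pos _} ℓ≢ = Falsified-forget λ { (refl , _) → ℓ≢ refl }
    Falsified-forget⁻ {f} {neg _} _  = Falsified-forget λ { (refl , eq) → neg-true f eq }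

    fresh : ∀ {L f} (r : Refuted L t ys f) → ¬ Queries y (Refuted.D r)
    fresh r q with Refuted.queries r y q
    ... | _ , inj₁ y∉t = y∉t y∈
    ... | _ , inj₂ y∈′ = y∉ y∈′

    forget-queries : ∀ {x} → inj₁ x ∈ᵗ t × (inj₁ x ∉ rootBag t ⊎ x ∈ ys) →
                     inj₁ x ∈ᵗ t × (inj₁ x ∉ rootBag t ⊎ x ∈ y ∷ ys)
    forget-queries (x∈ , inj₁ p) = x∈ , inj₁ p
    forget-queries (x∈ , inj₂ p) = x∈ , inj₂ (there p)

    -- The bound 2 is for the two premises of a resolution step; the resolvent is recorded only once
    -- it becomes a premise itself.
    Extension : List (Derivation n m) → State n m → Set
    Extension L f = ∃[ M ] (length M ≤ 2 × All (Avail L) M × Result (M ++ L) t (y ∷ ys) f)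

    resolveRefuted : ∀ {L f} → Refuted L t ys (f [ y ≔ true ]) → Refuted L t ys (f [ y ≔ false ]) →
                     Extension L f
    resolveRefuted {L} {f} r₁@(refuted D regD avD faD qD) r₀@(refuted E regE avE faE qE)
      with derives? (neg y) D | derives? (pos y) E
    ... | no ¬y∉D | _ = [] , z≤n , [] , inj₂ (refuted D regD avD
          (λ ℓ ℓ∈ → Falsified-forget⁺ (λ { refl → ¬y∉D ℓ∈ }) (faD ℓ ℓ∈))
          (λ x q → forget-queries (qD x q)))
    ... | yes _ | no y∉E = [] , z≤n , [] , inj₂ (refuted E regE avE
          (λ ℓ ℓ∈ → Falsified-forget⁻ (λ { refl → y∉E ℓ∈ }) (faE ℓ ℓ∈))
          (λ x q → forget-queries (qE x q)))
    ... | yes ¬y∈D | yes y∈E = D ∷ E ∷ [] , ℕ.≤-refl , avD ∷ avE ∷ [] ,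
          inj₂ (refuted (resolve y D E)
                 (resolve D≢E (fresh r₁) (fresh r₀) regD regE)
                 (λ { _ _ _ refl → here refl , there (here refl) })
                 (λ { ℓ (left ℓ∈ ℓ≢)  → Falsified-forget⁺ ℓ≢ (faD ℓ ℓ∈)
                    ; ℓ (right ℓ∈ ℓ≢) → Falsified-forget⁻ ℓ≢ (faE ℓ ℓ∈) })
                 qs)
      where
      D≢E : D ≢ E
      -- If the premises coincided, `E` would contain `neg y`, which is true under `y ≔ false`.
      D≢E refl = neg-true f (falsified-y {f [ y ≔ false ]} {neg y} refl (faE (neg y) ¬y∈D))
      qs : ∀ x → Queries x (resolve y D E) → inj₁ x ∈ᵗ t × (inj₁ x ∉ rootBag t ⊎ x ∈ y ∷ ys)
      qs x root      = root∈ t y∈ , inj₂ (here refl)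
      qs x (left q)  = forget-queries (qD x q)
      qs x (right q) = forget-queries (qE x q)

    query : ∀ {L} → (∀ f → Result L t ys f) → ∀ f → Extension L f
    query res f with res (f [ y ≔ true ]) | res (f [ y ≔ false ])
    ... | inj₁ M  | _       = [] , z≤n , [] , inj₁ (Model-forget true M)
    ... | inj₂ _  | inj₁ M  = [] , z≤n , [] , inj₁ (Model-forget false M)
    ... | inj₂ r₁ | inj₂ r₀ = resolveRefuted r₁ r₀

    queryAll : ∀ {L} → Closed L → (∀ f → Result L t ys f) →
      ∃[ L′ ] (Closed L′ × length L′ ≤ 2 ^ bagSize (rootBag t) * 2 + length L ×
               (∀ f → Result L′ t (y ∷ ys) f))
    queryAll {L} cl res
      -- Tabulating over the deduplicated bag makes the exponent exactly `bagSize`.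
      with tabulateAll _≟ᵛ_ (Avail L) 2 (deduplicate _≟ᵛ_ (rootBag t))
             (λ M → Result (M ++ L) t (y ∷ ys))
             (λ M⊆ → Result-mono (++⁺ M⊆ ⊆-refl))
             (λ f≗g → Result-cong (λ v v∈ → f≗g v (∈-deduplicate⁺ _≟ᵛ_ v∈)))
             (query res)
    ... | M , len , all , res′ = M ++ L , Closed-extend all cl ,
          ℕ.≤-trans (ℕ.≤-reflexive (length-++ M)) (ℕ.+-monoˡ-≤ (length L) len) , res′

  queryList : ∀ {L} t ys → Unique ys → All (λ y → inj₁ y ∈ rootBag t) ys →
    Closed L → (∀ f → Result L t [] f) →
    ∃[ L′ ] (Closed L′ × length L′ ≤ length ys * (2 ^ bagSize (rootBag t) * 2) + length L ×
             (∀ f → Result L′ t ys f))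
  queryList t [] _ _ cl res = _ , cl , ℕ.≤-refl , res
  queryList {L} t (y ∷ ys) u@(_ ∷ u′) (y∈ ∷ ys∈) cl res =
      let L₁ , cl₁ , len₁ , res₁ = queryList t ys u′ ys∈ cl res
          L₂ , cl₂ , len₂ , res₂ = Query.queryAll t y ys y∈ (Unique.Unique[x∷xs]⇒x∉xs u) cl₁ res₁
      in L₂ , cl₂ , accumulate _ (length ys * (2 ^ bagSize (rootBag t) * 2)) len₁ len₂ , res₂
    where
    accumulate : ∀ a b {c k k′} → k ≤ b + c → k′ ≤ a + k → k′ ≤ (a + b) + c
    accumulate a b {c} p q =
      ℕ.≤-trans q (ℕ.≤-trans (ℕ.+-monoʳ-≤ a p) (ℕ.≤-reflexive (sym (ℕ.+-assoc a b c))))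

  -- Joining the results of two children.

  module Join (B : Bag n m) (f : State n m) where

    -- Satisfaction by a variable invisible in `c` must be remembered in the flag. By `Edges`, a
    -- clause in `c` but not in `B` has all its variables in `c`, so its flag is rightly `false`.
    Carried : Tree n m → Fin m → Set
    Carried c j = inj₂ j ∈ B × (f (inj₂ j) ≡ true ⊎
      Any (λ ℓ → inj₁ (var ℓ) ∈ B × ¬ inj₁ (var ℓ) ∈ᵗ c × value f ℓ ≡ true) (φ j))

    carried? : ∀ c j → Dec (Carried c j)
    carried? c j = inj₂ j ∈? B ×-dec (f (inj₂ j) Bool.≟ true ⊎-dec
      any? (λ ℓ → inj₁ (var ℓ) ∈? B ×-dec (¬? (inj₁ (var ℓ) ∈ᵗ? c) ×-dec value f ℓ Bool.≟ true)) (φ j))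

    -- The values at variables new in `c` are arbitrary; the child is consulted only after these
    -- have been eliminated.
    carry : Tree n m → State n m
    carry c (inj₁ x) = f (inj₁ x)
    carry c (inj₂ j) = does (carried? c j)

    Satisfied : Fin m → Set
    Satisfied j = f (inj₂ j) ≡ true ⊎ Any (λ ℓ → inj₁ (var ℓ) ∈ B × value f ℓ ≡ true) (φ j)

    satisfied? : ∀ j → Dec (Satisfied j)
    satisfied? j = f (inj₂ j) Bool.≟ true ⊎-dec
      any? (λ ℓ → inj₁ (var ℓ) ∈? B ×-dec value f ℓ Bool.≟ true) (φ j)

    module _ {B₀ l r} (edges : Edges B₀ (node B l r)) where

      t : Tree n m
      t = node B l r

      -- The derivation is passed up unchanged. A root variable of `c` not eliminated there lies in
      -- `B`; a literal coming from an uncarried clause is either false in `B` or on a variable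
      -- outside `t`.
      liftRefuted : ∀ {L c c′} → Side B t c c′ → Edges B c →
                    Refuted L c (new B c) (carry c) → Refuted L t [] f
      liftRefuted {L} {c} {c′} side edgesᶜ (refuted D reg av fa q) =
        refuted D reg av (λ ℓ ℓ∈ → lift ℓ (fa ℓ ℓ∈)) (λ x p → liftQ x (q x p))
        where
        open Side side
        uncarried : ∀ ℓ {j} → ¬ inj₁ (var ℓ) ∈ᵗ c → inj₂ j ∈ rootBag c → ¬ Carried c j → ℓ ∈ φ j →
                    Falsified t [] f ℓ
        uncarried ℓ {j} x∉c j∈ ¬car ℓ∈ with inj₂ j ∈? B
        -- Were `j` outside `B`, this edge would be realised in `c`, where the variable does not
        -- occur.
        ... | no j∉B with edgesᶜ (occurs ℓ∈) (root∈ c j∈)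
        ...   | inj₁ s         = contradiction (mapSomewhere proj₁ s) x∉c
        ...   | inj₂ (j∈B , _) = contradiction j∈B j∉B
        uncarried ℓ {j} x∉c j∈ ¬car ℓ∈ | yes j∈B with inj₁ (var ℓ) ∈? B
        ... | yes x∈B = inj₁ (x∈B , (λ ()) , Bool.¬-not λ ev →
                ¬car (j∈B , inj₂ (lose ℓ∈ (x∈B , x∉c , ev))))
        ... | no x∉B = inj₂ (x∉t , j , j∈B , Bool.¬-not (λ ev → ¬car (j∈B , inj₁ ev)) , ℓ∈)
          where
          x∉t : ¬ inj₁ (var ℓ) ∈ᵗ t
          x∉t x∈t with edges (occurs ℓ∈) (up (root∈ c j∈))
          ... | inj₂ (_ , x↑) = x∉B (x↑ x∈t)
          ... | inj₁ s with split s
          ...   | inj₁ (x∈B , _) = x∉B x∈B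
          ...   | inj₂ (inj₁ s′) = x∉c (mapSomewhere proj₁ s′)
          -- Here one-sidedness enters: an edge realised in the sibling would put `j` into the root
          -- bags of both children.
          ...   | inj₂ (inj₂ s′) = one-sided j∈ (connects′ j∈B (mapSomewhere proj₂ s′))
        lift : ∀ ℓ → Falsified c (new B c) (carry c) ℓ → Falsified t [] f ℓ
        lift ℓ (inj₁ (x∈ , x∉ , eq)) with inj₁ (var ℓ) ∈? B
        ... | yes x∈B = inj₁ (x∈B , (λ ()) , eq)
        ... | no x∉B  = contradiction (∈new⁺ {t = c} x∈ x∉B) x∉
        lift ℓ (inj₂ (x∉c , j , j∈ , eq , ℓ∈)) = uncarried ℓ x∉c j∈ (does-false (carried? c j) eq) ℓ∈
        liftQ : ∀ x → inj₁ x ∈ᵗ c × (inj₁ x ∉ rootBag c ⊎ x ∈ new B c) →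
                inj₁ x ∈ᵗ t × (inj₁ x ∉ B ⊎ x ∈ [])
        liftQ x (x∈ , inj₁ x∉) = up x∈ , inj₁ λ x∈B → x∉ (connects x∈B x∈)
        liftQ x (x∈ , inj₂ p)  = up x∈ , inj₁ (proj₂ (∈new⁻ {t = c} p))

      Violated : Fin m → Set
      Violated j = inj₂ j ∈ B × inj₂ j ∉ rootBag l × inj₂ j ∉ rootBag r × ¬ Satisfied j

      violated? : ∀ j → Dec (Violated j)
      violated? j = inj₂ j ∈? B ×-dec (¬? (inj₂ j ∈? rootBag l) ×-dec
                    (¬? (inj₂ j ∈? rootBag r) ×-dec ¬? (satisfied? j)))

      -- The clause path ends at this node, so its edges within `t` are realised in `B` itself: each
      -- of its variables is in `B` or outside `t`.
      refuteViolated : ∀ {L j} → Connects B l → Connects B r → Violated j → Refuted L t [] f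
      refuteViolated {j = j} cl cr (j∈B , j∉l , j∉r , ¬sat) =
        refuted (axiom j) (axiom j) (λ _ _ _ ()) (λ { ℓ (axiom ℓ∈) → fals ℓ ℓ∈ }) (λ _ ())
        where
        fals : ∀ ℓ → ℓ ∈ φ j → Falsified t [] f ℓ
        fals ℓ ℓ∈ with inj₁ (var ℓ) ∈? B
        ... | yes x∈B = inj₁ (x∈B , (λ ()) , Bool.¬-not λ ev → ¬sat (inj₂ (lose ℓ∈ (x∈B , ev))))
        ... | no x∉B  = inj₂ (x∉t , j , j∈B , Bool.¬-not (¬sat ∘ inj₁) , ℓ∈)
          where
          x∉t : ¬ inj₁ (var ℓ) ∈ᵗ t
          x∉t x∈t with edges (occurs ℓ∈) (top j∈B)
          ... | inj₂ (_ , x↑)        = x∉B (x↑ x∈t)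
          ... | inj₁ (top (x∈B , _)) = x∉B x∈B
          ... | inj₁ (left s)        = j∉l (cl j∈B (mapSomewhere proj₂ s))
          ... | inj₁ (right s)       = j∉r (cr j∈B (mapSomewhere proj₂ s))

      module Glue (α : Assignment n) (α-B : ∀ x → inj₁ x ∈ B → α x ≡ f (inj₁ x)) where

        fromB : ∀ {j} → inj₂ j ∈ B → Satisfied j → (inj₂ j ∈ B × f (inj₂ j) ≡ true) ⊎ SatisfiedIn α t j
        fromB j∈ (inj₁ eq)  = inj₁ (j∈ , eq)
        fromB j∈ (inj₂ any) with find any
        ... | ℓ , ℓ∈ , x∈B , ev = inj₂ (ℓ , ℓ∈ , top x∈B , trans (evalLit-cong ℓ (α-B _ x∈B)) ev)

        -- If the child relied on its flag, the clause was carried, and the reason for carrying it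
        -- is visible in `f` and `B`.
        fromChild : ∀ {c c′} → Side B t c c′ → (M : Model c (new B c) (carry c)) →
                    (∀ x → inj₁ x ∈ᵗ c → α x ≡ Model.α M x) →
                    ∀ {j} → inj₂ j ∈ᵗ c → (inj₂ j ∈ B × f (inj₂ j) ≡ true) ⊎ SatisfiedIn α t j
        fromChild {c} side (model αᶜ _ sat) α-c {j} j∈ with sat j j∈
        ... | inj₂ (ℓ , ℓ∈ , x∈ , ev) =
              inj₂ (ℓ , ℓ∈ , Side.up side x∈ , trans (evalLit-cong ℓ (α-c _ x∈)) ev)
        ... | inj₁ (_ , eq) with does-true (carried? c j) eq
        ...   | j∈B , inj₁ e = fromB j∈B (inj₁ e)
        ...   | j∈B , inj₂ any with find any
        ...     | ℓ , ℓ∈ , x∈B , _ , ev = fromB j∈B (inj₂ (lose ℓ∈ (x∈B , ev)))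

      -- The sources of values agree where they overlap: both models follow `f` on `B`, whose
      -- variables are not new, and a variable of both subtrees is in `B`.
      glueModels : Side B t l r → Side B t r l → (∀ j → ¬ Violated j) →
        Model l (new B l) (carry l) → Model r (new B r) (carry r) → Model t [] f
      glueModels sideˡ sideʳ ok Mˡ Mʳ = model α (λ x x∈ _ → α-B x x∈) sat
        where
        α : Assignment n
        α x with inj₁ x ∈? B | inj₁ x ∈ᵗ? l
        ... | yes _ | _     = f (inj₁ x)
        ... | no _  | yes _ = Model.α Mˡ x
        ... | no _  | no _  = Model.α Mʳ x
        α-B : ∀ x → inj₁ x ∈ B → α x ≡ f (inj₁ x)
        α-B x x∈ with inj₁ x ∈? B
        ... | yes _  = refl
        ... | no x∉  = contradiction x∈ x∉
        agree : ∀ {c c′ x} → Side B t c c′ → (M : Model c (new B c) (carry c)) →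
                inj₁ x ∈ B → inj₁ x ∈ᵗ c → f (inj₁ x) ≡ Model.α M x
        agree {c} side M x∈B x∈ =
          sym (Model.agrees M _ (Side.connects side x∈B x∈) λ p → proj₂ (∈new⁻ {t = c} p) x∈B)
        α-l : ∀ x → inj₁ x ∈ᵗ l → α x ≡ Model.α Mˡ x
        α-l x x∈ with inj₁ x ∈? B | inj₁ x ∈ᵗ? l
        ... | yes x∈B | _     = agree sideˡ Mˡ x∈B x∈
        ... | no _    | yes _ = refl
        ... | no _    | no x∉ = contradiction x∈ x∉
        α-r : ∀ x → inj₁ x ∈ᵗ r → α x ≡ Model.α Mʳ x
        α-r x x∈ with inj₁ x ∈? B | inj₁ x ∈ᵗ? l
        ... | yes x∈B | _        = agree sideʳ Mʳ x∈B x∈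
        ... | no x∉B  | yes x∈l  = contradiction (Side.separates sideˡ x∈l x∈) x∉B
        ... | no _    | no _     = refl
        open Glue α α-B
        sat : ∀ j → inj₂ j ∈ᵗ t → (inj₂ j ∈ B × f (inj₂ j) ≡ true) ⊎ SatisfiedIn α t j
        sat j (left j∈)  = fromChild sideˡ Mˡ α-l j∈
        sat j (right j∈) = fromChild sideʳ Mʳ α-r j∈
        sat j (top j∈B) with inj₂ j ∈? rootBag l | inj₂ j ∈? rootBag r
        ... | yes j∈l | _       = fromChild sideˡ Mˡ α-l (root∈ l j∈l)
        ... | no _    | yes j∈r = fromChild sideʳ Mʳ α-r (root∈ r j∈r)
        ... | no j∉l  | no j∉r  =
              fromB j∈B (decidable-stable (satisfied? j) λ ¬s → ok j (j∈B , j∉l , j∉r , ¬s))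

      combine : ∀ {L} → Side B t l r → Side B t r l → Edges B l → Edges B r →
        Result L l (new B l) (carry l) → Result L r (new B r) (carry r) → Result L t [] f
      combine sˡ sʳ eˡ eʳ (inj₂ R) _        = inj₂ (liftRefuted sˡ eˡ R)
      combine sˡ sʳ eˡ eʳ (inj₁ _) (inj₂ R) = inj₂ (liftRefuted sʳ eʳ R)
      combine sˡ sʳ eˡ eʳ (inj₁ Mˡ) (inj₁ Mʳ) with Fin.any? violated?
      ... | yes (_ , v) = inj₂ (refuteViolated (Side.connects sˡ) (Side.connects sʳ) v)
      ... | no ¬v       = inj₁ (glueModels sˡ sʳ (λ j v → ¬v (j , v)) Mˡ Mʳ)

  -- `xs` lists the variables charged so far, each paying for a table of `2 ^ K` states with two
  -- premises per state.
  Solution : ℕ → Tree n m → List (Fin n) → List (Fin n) → Set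
  Solution K t xs ys =
    ∃[ L ] (Closed L × length L ≤ length xs * (2 ^ K * 2) × (∀ f → Result L t ys f))

  *-length-++ : ∀ {A : Set} c (xs ys : List A) {k l} → k ≤ length xs * c → l ≤ length ys * c →
                k + l ≤ length (xs ++ ys) * c
  *-length-++ c xs ys {k} {l} p q = begin
    k + l                            ≤⟨ ℕ.+-mono-≤ p q ⟩
    length xs * c + length ys * c    ≡⟨ ℕ.*-distribʳ-+ c (length xs) _ ⟨
    (length xs + length ys) * c      ≡⟨ cong (_* c) (length-++ xs) ⟨
    length (xs ++ ys) * c            ∎
    where open ℕ.≤-Reasoning

  -- Eliminates the variables hidden from the parent bag `B` before the join.
  enter : ∀ {K t} B → Sound K t → Solution K t (introduced t) [] →
          Solution K t (new B t ++ introduced t) (new B t)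
  enter {K} {t} B s (L , cl , len , res) =
    let L′ , cl′ , len′ , res′ =
          queryList t (new B t) (Unique.filter⁺ _ (Unique.allFin⁺ n))
            (All.tabulate λ p → proj₁ (∈new⁻ {B = B} {t = t} p)) cl res
    in L′ , cl′ ,
       ℕ.≤-trans len′ (*-length-++ (2 ^ K * 2) (new B t) (introduced t)
         (ℕ.*-monoʳ-≤ (length (new B t)) (ℕ.*-monoˡ-≤ 2 (ℕ.^-monoʳ-≤ 2 (rootSize s)))) len) ,
       res′

  solve : ∀ {K B₀ t} → Sound K t → Connects B₀ t → Edges B₀ t → Solution K t (introduced t) []
  solve nil _ _ = [] , [] , z≤n , λ f → inj₁ (model (λ _ → false) (λ _ ()) (λ _ ()))
  solve {K} {t = node B l r} s@(node _ cl cr _ _ sl sr) conn edges =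
    let edgesˡ = childEdges conn (leftSide s) edges
        edgesʳ = childEdges conn (rightSide s) edges
        L₁ , cl₁ , len₁ , res₁ = enter B sl (solve sl cl edgesˡ)
        L₂ , cl₂ , len₂ , res₂ = enter B sr (solve sr cr edgesʳ)
    in L₁ ++ L₂ , Closed-++ cl₁ cl₂ ,
       ℕ.≤-trans (ℕ.≤-reflexive (length-++ L₁))
         (*-length-++ (2 ^ K * 2) (new B l ++ introduced l) (new B r ++ introduced r) len₁ len₂) ,
       λ f → Join.combine B f edges (leftSide s) (rightSide s) edgesˡ edgesʳ
               (Result-mono ∈-++⁺ˡ (res₁ _)) (Result-mono (∈-++⁺ʳ L₁) (res₂ _))

-- From tree decompositions to local conditions

module _ {A : Set} where

  Walk : {t : BTree A} → (Pos t → Set) → Pos t → Pos t → Set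
  Walk S = Star (λ p q → S p × S q × (Child p q ⊎ Child q p))

  module _ {a : A} {t : BTree A} {S : Pos (nd1 a t) → Set} where

    exit₁ : ∀ {p} → Walk S (c1 p) here → S (c1 here)
    exit₁ ((_ , _ , inj₁ (in1 _)) ◅ w) = exit₁ w
    exit₁ ((s , _ , inj₂ ch1)     ◅ _) = s
    exit₁ ((_ , _ , inj₂ (in1 _)) ◅ w) = exit₁ w

    proj¹ : Pos (nd1 a t) → Pos t
    proj¹ here   = here
    proj¹ (c1 p) = p

    -- An excursion leaves and re-enters the subtree through its root, so it can be cut out by
    -- sending outside positions to that root.
    project₁ : ∀ {p q} → Walk S p (c1 q) → Walk (λ p → S (c1 p)) (proj¹ p) q
    project₁ ε = ε
    project₁ ((_ , _ , inj₁ ch1)     ◅ w) = project₁ w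
    project₁ ((_ , _ , inj₂ ch1)     ◅ w) = project₁ w
    project₁ ((s , s′ , inj₁ (in1 c)) ◅ w) = (s , s′ , inj₁ c) ◅ project₁ w
    project₁ ((s , s′ , inj₂ (in1 c)) ◅ w) = (s , s′ , inj₂ c) ◅ project₁ w

  module _ {a : A} {t u : BTree A} {S : Pos (nd2 a t u) → Set} where

    -- A walk leaving the subtree crosses the edge above its root. The endpoint is any outside
    -- position: `here` yields `Connects`, one in the right subtree yields separation.
    exitˡ : ∀ {p q} → Walk S (l2 p) q → (∀ p′ → q ≢ l2 p′) → S here × S (l2 here)
    exitˡ ε                                out = contradiction refl (out _)
    exitˡ ((_ , _  , inj₁ (inl2 _)) ◅ w) out = exitˡ w out
    exitˡ ((s , s′ , inj₂ chl)      ◅ _) _   = s′ , s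
    exitˡ ((_ , _  , inj₂ (inl2 _)) ◅ w) out = exitˡ w out

    exitʳ : ∀ {p} → Walk S (r2 p) here → S (r2 here)
    exitʳ ((_ , _ , inj₁ (inr2 _)) ◅ w) = exitʳ w
    exitʳ ((s , _ , inj₂ chr)      ◅ _) = s
    exitʳ ((_ , _ , inj₂ (inr2 _)) ◅ w) = exitʳ w

    projˡ : Pos (nd2 a t u) → Pos t
    projˡ here   = here
    projˡ (l2 p) = p
    projˡ (r2 _) = here

    projʳ : Pos (nd2 a t u) → Pos u
    projʳ here   = here
    projʳ (l2 _) = here
    projʳ (r2 p) = p

    projectˡ : ∀ {p q} → Walk S p (l2 q) → Walk (λ p → S (l2 p)) (projˡ p) q
    projectˡ ε = ε
    projectˡ ((_ , _  , inj₁ chl)      ◅ w) = projectˡ w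
    projectˡ ((_ , _  , inj₂ chl)      ◅ w) = projectˡ w
    projectˡ ((_ , _  , inj₁ chr)      ◅ w) = projectˡ w
    projectˡ ((_ , _  , inj₂ chr)      ◅ w) = projectˡ w
    projectˡ ((s , s′ , inj₁ (inl2 c)) ◅ w) = (s , s′ , inj₁ c) ◅ projectˡ w
    projectˡ ((s , s′ , inj₂ (inl2 c)) ◅ w) = (s , s′ , inj₂ c) ◅ projectˡ w
    projectˡ ((_ , _  , inj₁ (inr2 c)) ◅ w) = projectˡ w
    projectˡ ((_ , _  , inj₂ (inr2 c)) ◅ w) = projectˡ w

    projectʳ : ∀ {p q} → Walk S p (r2 q) → Walk (λ p → S (r2 p)) (projʳ p) q
    projectʳ ε = ε
    projectʳ ((_ , _  , inj₁ chl)      ◅ w) = projectʳ w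
    projectʳ ((_ , _  , inj₂ chl)      ◅ w) = projectʳ w
    projectʳ ((_ , _  , inj₁ chr)      ◅ w) = projectʳ w
    projectʳ ((_ , _  , inj₂ chr)      ◅ w) = projectʳ w
    projectʳ ((_ , _  , inj₁ (inl2 c)) ◅ w) = projectʳ w
    projectʳ ((_ , _  , inj₂ (inl2 c)) ◅ w) = projectʳ w
    projectʳ ((s , s′ , inj₁ (inr2 c)) ◅ w) = (s , s′ , inj₁ c) ◅ projectʳ w
    projectʳ ((s , s′ , inj₂ (inr2 c)) ◅ w) = (s , s′ , inj₂ c) ◅ projectʳ w

  below-c1 : ∀ {a} {t : BTree A} {p q} → c1 {a = a} {t} p ⊑ q → ∃[ q′ ] (q ≡ c1 q′ × p ⊑ q′)
  below-c1 ε            = _ , refl , ε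
  below-c1 (in1 c ◅ w) = let q′ , eq , w′ = below-c1 w in q′ , eq , c ◅ w′

  below-l2 : ∀ {a} {t u : BTree A} {p q} → l2 {a = a} {t} {u} p ⊑ q → ∃[ q′ ] (q ≡ l2 q′ × p ⊑ q′)
  below-l2 ε            = _ , refl , ε
  below-l2 (inl2 c ◅ w) = let q′ , eq , w′ = below-l2 w in q′ , eq , c ◅ w′

  below-r2 : ∀ {a} {t u : BTree A} {p q} → r2 {a = a} {t} {u} p ⊑ q → ∃[ q′ ] (q ≡ r2 q′ × p ⊑ q′)
  below-r2 ε            = _ , refl , ε
  below-r2 (inr2 c ◅ w) = let q′ , eq , w′ = below-r2 w in q′ , eq , c ◅ w′

module _ {n m : ℕ} where

  toTree : BTree (Bag n m) → Tree n m
  toTree (nd0 B)     = node B nil nil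
  toTree (nd1 B t)   = node B (toTree t) nil
  toTree (nd2 B t u) = node B (toTree t) (toTree u)

  rootBag-toTree : ∀ t → rootBag (toTree t) ≡ label t here
  rootBag-toTree (nd0 _)     = refl
  rootBag-toTree (nd1 _ _)   = refl
  rootBag-toTree (nd2 _ _ _) = refl

  somewhere⁻ : ∀ {Q} t → Somewhere Q (toTree t) → ∃[ p ] Q (label t p)
  somewhere⁻ (nd0 _)     (top q)   = here , q
  somewhere⁻ (nd1 _ _)   (top q)   = here , q
  somewhere⁻ (nd1 _ t)   (left s)  = let p , q = somewhere⁻ t s in c1 p , q
  somewhere⁻ (nd2 _ _ _) (top q)   = here , q
  somewhere⁻ (nd2 _ t _) (left s)  = let p , q = somewhere⁻ t s in l2 p , q
  somewhere⁻ (nd2 _ _ u) (right s) = let p , q = somewhere⁻ u s in r2 p , q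

  somewhere⁺ : ∀ {Q} t p → Q (label t p) → Somewhere Q (toTree t)
  somewhere⁺ (nd0 _)     here   q = top q
  somewhere⁺ (nd1 _ _)   here   q = top q
  somewhere⁺ (nd1 _ t)   (c1 p) q = left (somewhere⁺ t p q)
  somewhere⁺ (nd2 _ _ _) here   q = top q
  somewhere⁺ (nd2 _ t _) (l2 p) q = left (somewhere⁺ t p q)
  somewhere⁺ (nd2 _ _ u) (r2 p) q = right (somewhere⁺ u p q)

  AllConnected : BTree (Bag n m) → Set
  AllConnected t = ∀ v → Connected t (λ p → v ∈ label t p)

  -- Unlike `OneSided`, which forces every clause to occur, this is inherited by subtrees that miss
  -- some clauses.
  NonBranching : BTree (Bag n m) → Set
  NonBranching t = ∀ j p q → inj₂ j ∈ label t p → inj₂ j ∈ label t q → ∃[ b ] (p ⊑ b × q ⊑ b)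

  OneSided⇒NonBranching : ∀ t → OneSided t → NonBranching t
  OneSided⇒NonBranching t os j p q j∈p j∈q with os j
  ... | _ , b , _ , iff = b , proj₂ (proj₁ (iff p) j∈p) , proj₂ (proj₁ (iff q) j∈q)

  connects-toTree : ∀ {B} t → (∀ {v} p → v ∈ B → v ∈ label t p → v ∈ label t here) → Connects B (toTree t)
  connects-toTree t h {v} v∈B v∈t =
    let p , v∈p = somewhere⁻ t v∈t in subst (v ∈_) (sym (rootBag-toTree t)) (h p v∈B v∈p)

  sound : ∀ {K} t → maxBag t ≤ K → AllConnected t → NonBranching t → Sound K (toTree t)
  sound (nd0 B) len con nb = node len (λ _ ()) (λ _ ()) (λ ()) (λ ()) nil nil
  sound (nd1 B t) len con nb =
    node (ℕ.m⊔n≤o⇒m≤o (bagSize B) _ len)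
      (connects-toTree t λ {v} p v∈B v∈p → exit₁ {S = λ q → v ∈ label (nd1 B t) q} (con v (c1 p) here v∈p v∈B))
      (λ _ ()) (λ _ ()) (λ _ ())
      (sound t (ℕ.m⊔n≤o⇒n≤o (bagSize B) _ len)
        (λ v p q v∈p v∈q → project₁ {S = λ q → v ∈ label (nd1 B t) q} (con v (c1 p) (c1 q) v∈p v∈q))
        nb′)
      nil
    where
    nb′ : NonBranching t
    nb′ j p q j∈p j∈q with nb j (c1 p) (c1 q) j∈p j∈q
    ... | b , p⊑b , q⊑b with below-c1 p⊑b | below-c1 q⊑b
    ...   | b′ , refl , p⊑b′ | _ , refl , q⊑b′ = b′ , p⊑b′ , q⊑b′
  sound (nd2 B t u) len con nb =
    node (ℕ.m⊔n≤o⇒m≤o (bagSize B) _ len)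
      (connects-toTree t λ {v} p v∈B v∈p → proj₂ (exitˡ {S = S v} (con v (l2 p) here v∈p v∈B) λ _ ()))
      (connects-toTree u λ {v} p v∈B v∈p → exitʳ {S = S v} (con v (r2 p) here v∈p v∈B))
      (λ {v} v∈t v∈u → let p , v∈p = somewhere⁻ t v∈t
                           q , v∈q = somewhere⁻ u v∈u
                       in proj₁ (exitˡ {S = S v} (con v (l2 p) (r2 q) v∈p v∈q) λ _ ()))
      (λ {j} j∈t j∈u → fork j (subst (inj₂ j ∈_) (rootBag-toTree t) j∈t)
                              (subst (inj₂ j ∈_) (rootBag-toTree u) j∈u))
      (sound t (ℕ.m⊔n≤o⇒m≤o (maxBag t) _ len′)
        (λ v p q v∈p v∈q → projectˡ {S = S v} (con v (l2 p) (l2 q) v∈p v∈q)) nbˡ)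
      (sound u (ℕ.m⊔n≤o⇒n≤o (maxBag t) _ len′)
        (λ v p q v∈p v∈q → projectʳ {S = S v} (con v (r2 p) (r2 q) v∈p v∈q)) nbʳ)
    where
    len′ = ℕ.m⊔n≤o⇒n≤o (bagSize B) _ len
    S : Vertex n m → Pos (nd2 B t u) → Set
    S v p = v ∈ label (nd2 B t u) p
    -- A common descendant of the two children would lie in both subtrees.
    fork : ∀ j → inj₂ j ∈ label t here → inj₂ j ∉ label u here
    fork j j∈t j∈u with nb j (l2 here) (r2 here) j∈t j∈u
    ... | b , p⊑b , q⊑b with below-l2 p⊑b | below-r2 q⊑b
    ...   | _ , refl , _ | _ , () , _
    nbˡ : NonBranching t
    nbˡ j p q j∈p j∈q with nb j (l2 p) (l2 q) j∈p j∈q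
    ... | b , p⊑b , q⊑b with below-l2 p⊑b | below-l2 q⊑b
    ...   | b′ , refl , p⊑b′ | _ , refl , q⊑b′ = b′ , p⊑b′ , q⊑b′
    nbʳ : NonBranching u
    nbʳ j p q j∈p j∈q with nb j (r2 p) (r2 q) j∈p j∈q
    ... | b , p⊑b , q⊑b with below-r2 p⊑b | below-r2 q⊑b
    ...   | b′ , refl , p⊑b′ | _ , refl , q⊑b′ = b′ , p⊑b′ , q⊑b′

-- The refutation at the root and its size.

module _ {n m : ℕ} (φ : CNF n m) (T : BTree (Bag n m)) where

  open DP φ

  refute : Unsatisfiable φ → TreeDecomposition φ T → OneSided T →
           ∃[ s ] (s ≤ suc (n * (2 ^ maxBag T * 2)) × RegularRefutation φ s)
  -- The added root bag is empty, so any state may be chosen.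
  refute unsat td os = conclude (res (λ _ → false))
    where
    open TreeDecomposition td
    -- An empty bag above the root turns the variables of the old root bag into new ones, so they
    -- get eliminated as well.
    T⁺ : Tree n m
    T⁺ = node [] (toTree T) nil
    sound⁺ : Sound (maxBag T) T⁺
    sound⁺ = node z≤n (λ ()) (λ ()) (λ _ ()) (λ _ ())
               (sound T ℕ.≤-refl connected (OneSided⇒NonBranching T os)) nil
    edges⁺ : Edges [] T⁺
    edges⁺ {x} {j} occ _ = let p , x∈ , j∈ = edges x j occ in inj₁ (left (somewhere⁺ T p (x∈ , j∈)))
    solution : Solution (maxBag T) T⁺ (introduced T⁺) []
    solution = solve sound⁺ (λ ()) edges⁺
    L = proj₁ solution
    closed = proj₁ (proj₂ solution)
    len = proj₁ (proj₂ (proj₂ solution))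
    res = proj₂ (proj₂ (proj₂ solution))
    conclude : Result L T⁺ [] (λ _ → false) → ∃[ s ] (s ≤ suc (n * (2 ^ maxBag T * 2)) × RegularRefutation φ s)
    conclude (inj₁ (model α _ sat)) = contradiction (α , satisfies) unsat
      where
      satisfies : Satisfies α φ
      satisfies j with covers (inj₂ j)
      ... | p , j∈ with sat j (left (somewhere⁺ T p j∈))
      ...   | inj₂ (ℓ , ℓ∈ , _ , ev) = ℓ , ℓ∈ , ev
    conclude (inj₂ (refuted D reg av fa _)) = _ ,
      -- The final derivation joins the list of recorded premises, whence the `suc`.
      ℕ.≤-trans (length-nodes≤ (Closed-extend {M = D ∷ []} (av ∷ []) closed) (Any.here refl))
        (s≤s (ℕ.≤-trans len (ℕ.*-monoˡ-≤ _ (length-introduced sound⁺)))) ,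
      refutation
      where
      empty : ∀ ℓ → ¬ _∈ᶜ_ φ ℓ D
      empty ℓ ℓ∈ with fa ℓ ℓ∈
      ... | inj₁ (() , _)
      ... | inj₂ (_ , _ , () , _)
      open Dag φ D reg empty

-- From `M ≤ 1 + k` each variable costs at most `4 * 2 ^ k`, relaxed to `4 * 4 ^ k`; the summand 1
-- is absorbed by `n + 1`.
size-bound : ∀ n M {k} → M ∸ 1 ≡ k → suc (n * (2 ^ M * 2)) ≤ 4 * 4 ^ k * (n + 1)
size-bound n M {k} refl = begin
  1 + n * (2 ^ M * 2)              ≤⟨ ℕ.+-monoʳ-≤ 1 (ℕ.*-monoʳ-≤ n (ℕ.*-monoˡ-≤ 2 (ℕ.^-monoʳ-≤ 2 (ℕ.m≤n+m∸n M 1)))) ⟩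
  1 + n * (2 * 2 ^ k * 2)          ≤⟨ ℕ.+-monoʳ-≤ 1 (ℕ.*-monoʳ-≤ n (ℕ.*-monoˡ-≤ 2 (ℕ.*-monoʳ-≤ 2 (ℕ.^-monoˡ-≤ k (s≤s (s≤s z≤n)))))) ⟩
  1 + n * (2 * 4 ^ k * 2)          ≤⟨ ℕ.+-monoˡ-≤ _ (ℕ.≤-trans (ℕ.m^n>0 4 k) (ℕ.m≤n*m (4 ^ k) 4)) ⟩
  4 * 4 ^ k + n * (2 * 4 ^ k * 2)  ≡⟨ rearrange (4 ^ k) n ⟩
  4 * 4 ^ k * (n + 1)              ∎
  where
  open ℕ.≤-Reasoning
  open +-*-Solver
  rearrange : ∀ a n → 4 * a + n * (2 * a * 2) ≡ 4 * a * (n + 1)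
  rearrange = solve 2 (λ a n → con 4 :* a :+ n :* (con 2 :* a :* con 2) := con 4 :* a :* (n :+ con 1)) refl

theorem2 : ∃[ c ] (∀ (n m : ℕ) (φ : CNF n m) (T : BTree (Bag n m)) (k : ℕ) →
    Unsatisfiable φ → TreeDecomposition φ T → OneSided T → width T ≡ k →
    ∃[ s ] (s ≤ c * 4 ^ k * (n + 1) × RegularRefutation φ s))
theorem2 = 4 , λ n m φ T k unsat td os w →
  let s , s≤ , R = refute φ T unsat td os in s , ℕ.≤-trans s≤ (size-bound n (maxBag T) w) , R
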